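{- There is an absolute constant $c>0$ such that for every $n\ge1$ and every monotone Boolean function $f:\{0,1\}^n\to\{0,1\}$, $\mathsf{EC}(f)\ge c\cdot \mathsf{KW}^+(f)$; that is, $\mathsf{EC}(f)=\Omega(\mathsf{KW}^+(f))$.
   Context: A Boolean circuit $C$ over the basis $\mathcal{B}=\{\land_2,\lor_2,\lnot\}$ (AND and OR of fan-in 2, and NOT) is a directed acyclic graph with a root node of out-degree zero, input gates (in-degree zero) labeled by variables $x_1,\dots,x_n$, and non-input gates (including the root) labeled by functions in $\mathcal{B}$. For $a\in\{0,1\}^n$, $\mathsf{EC}(C,a)$ is the number of non-input gates of $C$ that output $1$ on $a$; $\mathsf{EC}(C)=\max_a\mathsf{EC}(C,a)$; $\mathsf{EC}(f)$ is the minimum of $\mathsf{EC}(C)$ over all (not necessarily monotone) circuits $C$ over $\mathcal{B}$ computing $f$. $f$ is monotone if $x_i\le y_i$ for all $i$ implies $f(x)\le f(y)$. For a monotone $f$, the monotone Karchmer-Wigderson game is the two-party communication problem in which Alice holds $x\in f^{ -1}(1)$, Bob holds $y\in f^{ -1}(0)$, and they must agree on an index $i$ with $x_i=1$ and $y_i=0$. $\mathsf{KW}^+(f)$ is the optimal deterministic (worst-case) communication cost of this problem ($0$ if $f$ is constant); it equals the minimum depth of a monotone fan-in-2 Boolean circuit computing $f$ when $f$ is non-constant. -}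

module Defs where

open import Data.Bool.Base using (Bool; true; false; _∧_; _∨_; not)
import Data.Bool.Base as Bool
open import Data.Fin.Base using (Fin)
open import Data.Integer.Base using (+_)
open import Data.Nat.Base using (ℕ; zero; suc; _≤_; _⊔_)
open import Data.Product.Base using (∃; _×_; proj₁)
open import Data.Rational.Base using (ℚ; _/_)
open import Data.Sum.Base using (_⊎_; inj₁; inj₂)
open import Data.Vec.Base using (Vec; []; _∷_; head; lookup; countᵇ)
open import Function.Base using (id)
open import Relation.Binary.PropositionalEquality.Core using (_≡_)

BoolFun : ℕ → Set
BoolFun n = Vec Bool n → Bool

Monotone : ∀ {n} → BoolFun n → Set
Monotone f = ∀ x y → (∀ i → lookup x i Bool.≤ lookup y i) → f x Bool.≤ f y

IsMinimum : (ℕ → Set) → ℕ → Set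
IsMinimum P m = P m × (∀ k → P k → m ≤ k)

fromℕ : ℕ → ℚ
fromℕ m = + m / 1

------------------------------------------------------------------------
-- Circuits

-- A directed acyclic graph is given by a topological order of its
-- non-input gates.  A node is an input gate (inj₁ i, labelled by the
-- i-th variable) or one of the s non-input gates placed so far (inj₂ j);
-- among the latter, index zero is the most recently placed gate.

Node : ℕ → ℕ → Set
Node n s = Fin n ⊎ Fin s

data Gate (n s : ℕ) : Set where
  and₂ or₂ : Node n s → Node n s → Gate n s
  neg      : Node n s → Gate n s

infixl 5 _▷_

data Gates (n : ℕ) : ℕ → Set where
  ∅   : Gates n zero
  _▷_ : ∀ {s} → Gates n s → Gate n s → Gates n (suc s)

-- The root is the last gate.  It is therefore a non-input gate and no
-- gate reads it, i.e. it has out-degree zero.  No bound is put on the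
-- fan-out of the other nodes.

record Circuit (n : ℕ) : Set where
  constructor circuit
  field
    {size-1} : ℕ
    gates    : Gates n (suc size-1)

module _ {n : ℕ} where

  nodeValue : ∀ {s} → Vec Bool n → Vec Bool s → Node n s → Bool
  nodeValue a v (inj₁ i) = lookup a i
  nodeValue a v (inj₂ j) = lookup v j

  gateValue : ∀ {s} → Vec Bool n → Vec Bool s → Gate n s → Bool
  gateValue a v (and₂ p q) = nodeValue a v p ∧ nodeValue a v q
  gateValue a v (or₂ p q)  = nodeValue a v p ∨ nodeValue a v q
  gateValue a v (neg p)    = not (nodeValue a v p)

  gateValues : ∀ {s} → Gates n s → Vec Bool n → Vec Bool s
  gateValues ∅        a = []
  gateValues (gs ▷ g) a = gateValue a (gateValues gs a) g ∷ gateValues gs a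

  eval : Circuit n → BoolFun n
  eval C a = head (gateValues (Circuit.gates C) a)

  Computes : Circuit n → BoolFun n → Set
  Computes C f = ∀ a → eval C a ≡ f a

------------------------------------------------------------------------
-- Energy complexity

-- The maximum of g over the whole cube {0,1}ⁿ.
maxCube : ∀ n → (Vec Bool n → ℕ) → ℕ
maxCube zero    g = g []
maxCube (suc n) g =
  maxCube n (λ a → g (false ∷ a)) ⊔ maxCube n (λ a → g (true ∷ a))

energyAt : ∀ {n} → Circuit n → Vec Bool n → ℕ
energyAt C a = countᵇ id (gateValues (Circuit.gates C) a)

energy : ∀ {n} → Circuit n → ℕ
energy {n} C = maxCube n (energyAt C)

-- IsEC f e says EC(f) = e.  The minimum is a relation rather than a
-- function because it ranges over infinitely many circuits.
IsEC : ∀ {n} → BoolFun n → ℕ → Set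
IsEC {n} f = IsMinimum (λ e → ∃ λ (C : Circuit n) → Computes C f × energy C ≡ e)

------------------------------------------------------------------------
-- Monotone Karchmer–Wigderson games

-- Deterministic protocols with inputs in X (Alice) and Y (Bob).  At an
-- inner node its owner sends one bit, computed from the owner's input
-- alone; false leads to the first subtree and true to the second.
data Protocol (X Y Z : Set) : Set where
  answer : Z → Protocol X Y Z
  alice  : (X → Bool) → (l r : Protocol X Y Z) → Protocol X Y Z
  bob    : (Y → Bool) → (l r : Protocol X Y Z) → Protocol X Y Z

module _ {X Y Z : Set} where

  run : Protocol X Y Z → X → Y → Z
  run (answer z)    x y = z
  run (alice m l r) x y = Bool.if m x then run r x y else run l x y
  run (bob m l r)   x y = Bool.if m y then run r x y else run l x y

  cost : Protocol X Y Z → ℕ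
  cost (answer z)    = 0
  cost (alice m l r) = suc (cost l ⊔ cost r)
  cost (bob m l r)   = suc (cost l ⊔ cost r)

Preimage : ∀ {n} → BoolFun n → Bool → Set
Preimage {n} f b = ∃ λ (x : Vec Bool n) → f x ≡ b

KWProtocol : ∀ {n} → BoolFun n → Set
KWProtocol {n} f = Protocol (Preimage f true) (Preimage f false) (Fin n)

SolvesKW⁺ : ∀ {n} (f : BoolFun n) → KWProtocol f → Set
SolvesKW⁺ f π = ∀ x y →
  let i = run π x y in
  lookup (proj₁ x) i ≡ true × lookup (proj₁ y) i ≡ false

-- IsKW⁺ f k says KW⁺(f) = k.  If f is constant and n ≥ 1, one of the
-- players has no input, any single leaf solves the game, and KW⁺(f) = 0
-- as the usual convention requires.
IsKW⁺ : ∀ {n} → BoolFun n → ℕ → Set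
IsKW⁺ f = IsMinimum (λ k → ∃ λ (π : KWProtocol f) → SolvesKW⁺ f π × cost π ≡ k)

{-# OPTIONS --safe #-}
-- Let C compute the monotone function f with energy e.  Reveal C from the
-- root downwards.  If an AND gate is known to be 1, so are both its inputs;
-- if an OR gate is known to be 1, Alice names an input that is 1; at a NOT
-- gate Alice sends the value of its input, unless it is known already.
-- Whenever a variable x_i is found to be 1, Bob checks y_i, and the game is
-- over if y_i = 0.  If this never happens, then C has the same value at x
-- and at z = x ∧ y: the negated nodes agree, and every node known to be 1
-- at x is still justified at z.  So f z = 1, contradicting f z ≤ f y = 0.
--
-- A gate costs bits only if it is an AND or OR gate firing on x, or a NOT
-- gate with input p not known before.  In the latter case either the NOT
-- gate or p fires on the all-zero input, and p, now known, is never charged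
-- again.  Each charge is for at most two bits, so at most 6 e bits are sent.
module Submission where

open import Defs
open import Data.Bool.Base using (Bool; true; false; _∧_; _∨_; not; T; if_then_else_; b≤b)
import Data.Bool.Base as Bool
import Data.Bool.Properties as Bool
open import Data.Empty using (⊥-elim)
open import Data.Fin.Base using (Fin; zero; suc)
import Data.Fin.Properties as Fin
import Data.Integer.Base as ℤ
import Data.Integer.Properties as ℤ
open import Data.Maybe.Base using (Maybe; just; nothing; is-just)
open import Data.Maybe.Properties using (just-injective)
open import Data.Nat.Base using (ℕ; zero; suc; _+_; _*_; _⊔_; _≤_; _<_; _≥_; z≤n; s≤s)
open import Data.Nat.Properties
open import Data.Nat.Solver using (module +-*-Solver)
open import Data.Product.Base using (∃; _×_; _,_; proj₁; proj₂)
open import Data.Rational.Base using (ℚ; 0ℚ; _>_; _/_; toℚᵘ) renaming (_*_ to _*ℚ_; _≥_ to _≥ℚ_)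
import Data.Rational.Properties as ℚ
import Data.Rational.Unnormalised.Base as ℚᵘ
open import Data.Rational.Unnormalised.Base using (mkℚᵘ; *≤*)
import Data.Rational.Unnormalised.Properties as ℚᵘ
open import Data.Sum.Base using (_⊎_; inj₁; inj₂; map₂)
open import Data.Unit.Base using (tt)
import Data.Vec.Base as Vec
open import Data.Vec.Base using (Vec; []; _∷_; lookup; replicate; zipWith; countᵇ; _[_]≔_)
open import Data.Vec.Properties using (lookup-zipWith; lookup-replicate; lookup∘update; lookup∘update′)
open import Function.Base using (id; _∘_)
open import Relation.Binary.PropositionalEquality
open import Relation.Nullary using (yes; no)

-- Inequalities for Booleans, rationals and the cube

∧-mono-≤ : ∀ {a b c d} → a Bool.≤ b → c Bool.≤ d → a ∧ c Bool.≤ b ∧ d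
∧-mono-≤ {false}       _   _   = Bool.≤-minimum _
∧-mono-≤ {true} {true} b≤b c≤d = c≤d

∨-mono-≤ : ∀ {a b c d} → a Bool.≤ b → c Bool.≤ d → a ∨ c Bool.≤ b ∨ d
∨-mono-≤ {false} {false} _   c≤d = c≤d
∨-mono-≤ {a}     {true}  _   _   = Bool.≤-maximum _
∨-mono-≤ {true}  {false} ()

∧-trueˡ : ∀ {a b} → a ∧ b ≡ true → a ≡ true
∧-trueˡ {true} _ = refl

∧-trueʳ : ∀ {a b} → a ∧ b ≡ true → b ≡ true
∧-trueʳ {true} b≡true = b≡true

1/6*m≤n : ∀ m n → m ≤ 6 * n → fromℕ n ≥ℚ ((ℤ.+ 1 / 6) *ℚ fromℕ m)
1/6*m≤n m n m≤6n = ℚ.toℚᵘ-cancel-≤ (begin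
  toℚᵘ ((ℤ.+ 1 / 6) *ℚ fromℕ m)            ≃⟨ ℚ.toℚᵘ-homo-* (ℤ.+ 1 / 6) (fromℕ m) ⟩
  toℚᵘ (ℤ.+ 1 / 6) ℚᵘ.* toℚᵘ (fromℕ m)     ≃⟨ ℚᵘ.*-congˡ {toℚᵘ (ℤ.+ 1 / 6)} (ℚ.toℚᵘ-fromℚᵘ (mkℚᵘ (ℤ.+ m) 0)) ⟩
  mkℚᵘ (ℤ.+ 1) 5 ℚᵘ.* mkℚᵘ (ℤ.+ m) 0       ≤⟨ *≤* cross ⟩
  mkℚᵘ (ℤ.+ n) 0                           ≃⟨ ℚ.toℚᵘ-fromℚᵘ (mkℚᵘ (ℤ.+ n) 0) ⟨
  toℚᵘ (fromℕ n)                           ∎)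
  where
  open ℚᵘ.≤-Reasoning
  cross : (ℤ.+ 1 ℤ.* ℤ.+ m) ℤ.* ℤ.+ 1 ℤ.≤ ℤ.+ n ℤ.* ℤ.+ 6
  cross = subst₂ ℤ._≤_
    (sym (trans (ℤ.*-identityʳ _) (ℤ.*-identityˡ _)))
    (trans (cong ℤ.+_ (*-comm 6 n)) (ℤ.pos-* n 6))
    (ℤ.+≤+ m≤6n)

≤-maxCube : ∀ {n} (g : Vec Bool n → ℕ) a → g a ≤ maxCube n g
≤-maxCube g []          = ≤-refl
≤-maxCube g (false ∷ a) = m≤n⇒m≤n⊔o _ (≤-maxCube (g ∘ (false ∷_)) a)
≤-maxCube g (true  ∷ a) = m≤n⇒m≤o⊔n _ (≤-maxCube (g ∘ (true ∷_)) a)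

-- Lengths of runs and truncation of protocols

module _ {X Y Z : Set} where

  steps : Protocol X Y Z → X → Y → ℕ
  steps (answer z)    x y = 0
  steps (alice m l r) x y = suc (if m x then steps r x y else steps l x y)
  steps (bob m l r)   x y = suc (if m y then steps r x y else steps l x y)

  -- The cost of a protocol also counts branches that no input reaches, so
  -- a bound on the steps of all runs bounds only the cost of a truncation.
  truncate : Z → ℕ → Protocol X Y Z → Protocol X Y Z
  truncate z d       (answer w)    = answer w
  truncate z zero    _             = answer z
  truncate z (suc d) (alice m l r) = alice m (truncate z d l) (truncate z d r)
  truncate z (suc d) (bob m l r)   = bob m (truncate z d l) (truncate z d r)

  cost-truncate : ∀ z d π → cost (truncate z d π) ≤ d
  cost-truncate z zero    (answer _)    = z≤n
  cost-truncate z zero    (alice _ _ _) = z≤n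
  cost-truncate z zero    (bob _ _ _)   = z≤n
  cost-truncate z (suc d) (answer _)    = z≤n
  cost-truncate z (suc d) (alice m l r) = s≤s (⊔-lub (cost-truncate z d l) (cost-truncate z d r))
  cost-truncate z (suc d) (bob m l r)   = s≤s (⊔-lub (cost-truncate z d l) (cost-truncate z d r))

  run-truncate : ∀ z d π {x y} → steps π x y ≤ d → run (truncate z d π) x y ≡ run π x y
  run-truncate z zero    (answer _)    _ = refl
  run-truncate z (suc d) (answer _)    _ = refl
  run-truncate z (suc d) (alice m l r) {x} (s≤s b) with m x
  ... | true  = run-truncate z d r b
  ... | false = run-truncate z d l b
  run-truncate z (suc d) (bob m l r) {y = y} (s≤s b) with m y
  ... | true  = run-truncate z d r b
  ... | false = run-truncate z d l b

-- Common knowledge about gate values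

-- The values of gates that are common knowledge.
State : ℕ → Set
State s = Vec (Maybe Bool) s

Known : ∀ {s} → State s → Fin s → Set
Known st j = T (is-just (lookup st j))

infix 4 _⊑_

-- Compares only the sets of known gates; `Consistent` separately ties the recorded values to actual
-- ones.
record _⊑_ {s} (st st′ : State s) : Set where
  constructor mk⊑
  field preserve : ∀ j → Known st j → Known st′ j

open _⊑_

⊑-refl : ∀ {s} {st : State s} → st ⊑ st
⊑-refl = mk⊑ λ _ → id

⊑-trans : ∀ {s} {st st′ st″ : State s} → st ⊑ st′ → st′ ⊑ st″ → st ⊑ st″
⊑-trans p q = mk⊑ λ j → preserve q j ∘ preserve p j

⊑-tail : ∀ {s m m′} {st st′ : State s} → m ∷ st ⊑ m′ ∷ st′ → st ⊑ st′
⊑-tail p = mk⊑ (preserve p ∘ suc)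

record Consistent {s} (st : State s) (v : Vec Bool s) : Set where
  constructor mkConsistent
  field correct : ∀ j {c} → lookup st j ≡ just c → lookup v j ≡ c

open Consistent

consistent-tail : ∀ {s m b} {st : State s} {v} → Consistent (m ∷ st) (b ∷ v) → Consistent st v
consistent-tail cons = mkConsistent (correct cons ∘ suc)

known-update : ∀ {s} (st : State s) j b → Known (st [ j ]≔ just b) j
known-update st j b = subst (T ∘ is-just) (sym (lookup∘update j st (just b))) tt

⊑-update : ∀ {s} (st : State s) j b → st ⊑ st [ j ]≔ just b
⊑-update st j b = mk⊑ stays
  where
  stays : ∀ i → Known st i → Known (st [ j ]≔ just b) i
  stays i known with i Fin.≟ j
  ... | yes refl = known-update st j b
  ... | no  i≢j  = subst (T ∘ is-just) (sym (lookup∘update′ i≢j st (just b))) known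

-- Lets a single state bound all later states in which gate `j` is known, whichever value was
-- recorded there.
update-least : ∀ {s} {st st′ : State s} j {b} → st ⊑ st′ → Known st′ j → st [ j ]≔ just b ⊑ st′
update-least {st = st} {st′} j {b} sub known = mk⊑ in-st′
  where
  in-st′ : ∀ i → Known (st [ j ]≔ just b) i → Known st′ i
  in-st′ i kᵢ with i Fin.≟ j
  ... | yes refl = known
  ... | no  i≢j  = preserve sub i (subst (T ∘ is-just) (lookup∘update′ i≢j st (just b)) kᵢ)

consistent-update : ∀ {s} {st : State s} {v} j → Consistent st v →
                    Consistent (st [ j ]≔ just (lookup v j)) v
consistent-update {st = st} {v} j cons = mkConsistent still
  where
  still : ∀ i {c} → lookup (st [ j ]≔ just (lookup v j)) i ≡ just c → lookup v i ≡ c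
  still i eq with i Fin.≟ j
  ... | yes refl = just-injective (trans (sym (lookup∘update j st (just (lookup v j)))) eq)
  ... | no  i≢j  = correct cons i (trans (sym (lookup∘update′ i≢j st (just (lookup v j)))) eq)

-- Counting firing gates

firing : ∀ {s} → Vec Bool s → ℕ
firing = countᵇ id

firing-∷ : ∀ {s} b (v : Vec Bool s) → firing v ≤ firing (b ∷ v)
firing-∷ true  v = n≤1+n _
firing-∷ false v = ≤-refl

-- A potential: at the all-zero input it counts the gates that can still be charged as the input of
-- a NOT gate. Such a charge makes the gate known and lowers the count.
pending : ∀ {s} → State s → Vec Bool s → ℕ
pending []             []          = 0
pending (nothing ∷ st) (true  ∷ v) = suc (pending st v)
pending (nothing ∷ st) (false ∷ v) = pending st v
pending (just _  ∷ st) (_     ∷ v) = pending st v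

pending-∷ : ∀ {s} m b (st : State s) v → pending st v ≤ pending (m ∷ st) (b ∷ v)
pending-∷ nothing  true  st v = n≤1+n _
pending-∷ nothing  false st v = ≤-refl
pending-∷ (just _) _     st v = ≤-refl

pending≤firing : ∀ {s} (st : State s) v → pending st v ≤ firing v
pending≤firing []             []          = z≤n
pending≤firing (nothing ∷ st) (true  ∷ v) = s≤s (pending≤firing st v)
pending≤firing (nothing ∷ st) (false ∷ v) = pending≤firing st v
pending≤firing (just _  ∷ st) (b     ∷ v) = ≤-trans (pending≤firing st v) (firing-∷ b v)

pending-anti : ∀ {s} {st st′ : State s} → st ⊑ st′ → ∀ v → pending st′ v ≤ pending st v
pending-anti {st = []}           {[]}          sub []          = z≤n
pending-anti {st = nothing ∷ _}  {nothing ∷ _} sub (true  ∷ v) = s≤s (pending-anti (⊑-tail sub) v)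
pending-anti {st = nothing ∷ _}  {nothing ∷ _} sub (false ∷ v) = pending-anti (⊑-tail sub) v
pending-anti {st = nothing ∷ st} {just _ ∷ _}  sub (b     ∷ v) =
  ≤-trans (pending-anti (⊑-tail sub) v) (pending-∷ nothing b st v)
pending-anti {st = just _ ∷ _}   {nothing ∷ _} sub (_     ∷ v) = ⊥-elim (preserve sub zero tt)
pending-anti {st = just _ ∷ _}   {just _ ∷ _}  sub (_     ∷ v) = pending-anti (⊑-tail sub) v

-- Position `j` is counted for `st` but not for `st′`, and no position becomes newly counted.
pending-strict : ∀ {s} {st st′ : State s} → st ⊑ st′ → ∀ v j →
                 is-just (lookup st j) ≡ false → Known st′ j → lookup v j ≡ true →
                 pending st′ v < pending st v
pending-strict {st = nothing ∷ _}  {just _ ∷ _}  sub (true  ∷ v) zero    _ _ _ = s≤s (pending-anti (⊑-tail sub) v)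
pending-strict {st = nothing ∷ _}  {nothing ∷ _} sub (true  ∷ v) (suc j) u k e = s≤s (pending-strict (⊑-tail sub) v j u k e)
pending-strict {st = nothing ∷ _}  {nothing ∷ _} sub (false ∷ v) (suc j) u k e = pending-strict (⊑-tail sub) v j u k e
pending-strict {st = nothing ∷ st} {just _ ∷ _}  sub (b     ∷ v) (suc j) u k e =
  ≤-trans (pending-strict (⊑-tail sub) v j u k e) (pending-∷ nothing b st v)
pending-strict {st = just _ ∷ _}   {nothing ∷ _} sub (_     ∷ v) (suc j) u k e = ⊥-elim (preserve sub zero tt)
pending-strict {st = just _ ∷ _}   {just _ ∷ _}  sub (_     ∷ v) (suc j) u k e = pending-strict (⊑-tail sub) v j u k e

-- The protocol

-- The answer default is given only on runs that no pair of inputs produces.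
module Game {n : ℕ} (f : BoolFun n) (default : Fin n) where

  known? : ∀ {s} → State s → Node n s → Bool
  known? st (inj₁ i) = false
  known? st (inj₂ j) = is-just (lookup st j)

  -- Only a variable that is 1 at x needs a bit from Bob: one that is 0 at x is also 0 at x ∧ y, and
  -- the value of a gate is just recorded.
  settle : ∀ {s} → Node n s → Bool → State s → (State s → KWProtocol f) → KWProtocol f
  settle (inj₁ i) true  st π = bob (λ y → lookup (proj₁ y) i) (answer i) (π st)
  settle (inj₁ i) false st π = π st
  settle (inj₂ j) b     st π = π (st [ j ]≔ just b)

  reveal : ∀ {s} → Gates n s → Node n s → Preimage f true → Bool
  reveal gs p x = nodeValue (proj₁ x) (gateValues gs (proj₁ x)) p

  -- NOT gates are treated whatever is known about their output, so that every negated node agrees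
  -- at x and x ∧ y. All gate values at x ∧ y are then at most those at x, and only gates known to
  -- be 1 call for a justification.
  protocol : ∀ {s} → Gates n s → State s → KWProtocol f
  protocol ∅ _ = answer default
  protocol (gs ▷ and₂ p q) (just true ∷ st) =
    settle p true st (λ st′ → settle q true st′ (protocol gs))
  protocol (gs ▷ or₂ p q) (just true ∷ st) =
    -- If Alice reports that `p` is 0, then `q` must be 1.
    alice (reveal gs p) (settle q true st (protocol gs)) (settle p true st (protocol gs))
  protocol (gs ▷ neg p) (_ ∷ st) =
    if known? st p then protocol gs st
    else alice (reveal gs p) (settle p false st (protocol gs)) (settle p true st (protocol gs))
  protocol (gs ▷ _) (_ ∷ st) = protocol gs st

  -- A single run on a fixed pair of inputs

  module Run (x : Preimage f true) (y : Preimage f false) where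

    a z 𝟎 : Vec Bool n
    a = proj₁ x
    z = zipWith _∧_ a (proj₁ y)
    𝟎 = replicate n false

    z≡a∧y : ∀ i → lookup z i ≡ lookup a i ∧ lookup (proj₁ y) i
    z≡a∧y i = lookup-zipWith _∧_ i a (proj₁ y)

    z≤y : ∀ i → lookup z i Bool.≤ lookup (proj₁ y) i
    z≤y i rewrite z≡a∧y i = ∧-mono-≤ (Bool.≤-maximum (lookup a i)) Bool.≤-refl

    z≤a : ∀ i → lookup z i Bool.≤ lookup a i
    z≤a i = subst₂ Bool._≤_ (sym (z≡a∧y i)) (Bool.∧-identityʳ _)
              (∧-mono-≤ {lookup a i} Bool.≤-refl (Bool.≤-maximum (lookup (proj₁ y) i)))

    at-𝟎 at-a at-z : ∀ {s} → Gates n s → Node n s → Bool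
    at-𝟎 gs = nodeValue 𝟎 (gateValues gs 𝟎)
    at-a gs = nodeValue a (gateValues gs a)
    at-z gs = nodeValue z (gateValues gs z)

    Wins : Fin n → Set
    Wins i = lookup a i ≡ true × lookup (proj₁ y) i ≡ false

    -- `R` is what is gained when the run passes all gates without finding a winning index. It
    -- becomes agreement at `a` and `z`, which is refuted at the root.
    record Play (R : Set) (d : ℕ) (π : KWProtocol f) : Set where
      constructor mkPlay
      field
        short   : steps π x y ≤ d
        outcome : Wins (run π x y) ⊎ R

    weaken : ∀ {R S d e π} → d ≤ e → (R → S) → Play R d π → Play S e π
    weaken d≤e g (mkPlay b o) = mkPlay (≤-trans b d≤e) (map₂ g o)

    -- Stated for a bare bit, so that one case split reduces both the step count and the outcome,
    -- for either player.
    by-bit : ∀ {R d l r} b → (b ≡ true → Play R d r) → (b ≡ false → Play R d l) →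
      suc (if b then steps r x y else steps l x y) ≤ suc d ×
      (Wins (if b then run r x y else run l x y) ⊎ R)
    by-bit true  on-true on-false with mkPlay b o ← on-true refl  = s≤s b , o
    by-bit false on-true on-false with mkPlay b o ← on-false refl = s≤s b , o

    alice-play : ∀ {R d} m {l r} → (m x ≡ true → Play R d r) → (m x ≡ false → Play R d l) →
                 Play R (suc d) (alice m l r)
    alice-play m on-true on-false with b , o ← by-bit (m x) on-true on-false = mkPlay b o

    bob-play : ∀ {R d} m {l r} → (m y ≡ true → Play R d r) → (m y ≡ false → Play R d l) →
               Play R (suc d) (bob m l r)
    bob-play m on-true on-false with b , o ← by-bit (m y) on-true on-false = mkPlay b o

    -- For a variable, agreement is established at once. For a gate only its being known is
    -- recorded, since agreement there follows only after the gates below have been played.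
    data Settled {s} (st : State s) : Node n s → Set where
      input : ∀ {i} → lookup z i ≡ lookup a i → Settled st (inj₁ i)
      gate  : ∀ {j} → Known st j → Settled st (inj₂ j)

    settled-⊑ : ∀ {s} {st st′ : State s} {p} → st ⊑ st′ → Settled st p → Settled st′ p
    settled-⊑ sub (input eq)   = input eq
    settled-⊑ sub (gate known) = gate (preserve sub _ known)

    known⇒settled : ∀ {s} {st : State s} p → known? st p ≡ true → Settled st p
    known⇒settled (inj₂ j) eq = gate (subst T (sym eq) tt)

    -- One bit is allowed in every case, although only Bob's check spends it. His 0 wins the game,
    -- and his 1 gives equality at `z` and `a`.
    settle-play : ∀ {s} {st : State s} {v R d π} p b → nodeValue a v p ≡ b → Consistent st v →
      (∀ st′ → Consistent st′ v → st ⊑ st′ → Settled st′ p → Play R d (π st′)) →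
      Play R (suc d) (settle p b st π)
    settle-play {st = st} (inj₁ i) true aᵢ cons k = bob-play (λ y → lookup (proj₁ y) i)
      (λ yᵢ → k st cons ⊑-refl (input (trans (z≡a∧y i) (trans (cong₂ _∧_ aᵢ yᵢ) (sym aᵢ)))))
      (λ yᵢ → mkPlay z≤n (inj₁ (aᵢ , yᵢ)))
    settle-play {st = st} (inj₁ i) false aᵢ cons k =
      weaken (n≤1+n _) id (k st cons ⊑-refl
        (input (trans (z≡a∧y i) (trans (cong (_∧ lookup (proj₁ y) i) aᵢ) (sym aᵢ)))))
    settle-play {st = st} (inj₂ j) b refl cons k =
      weaken (n≤1+n _) id (k _ (consistent-update j cons) (⊑-update st j _)
        (gate (known-update st j b)))

    -- Agreement at `a` and `z`, and the budget of bits

    record Agree {s} (gs : Gates n s) (st : State s) : Set where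
      constructor mkAgree
      field
        -- This can hold in a circuit with negations because the negated nodes have been made equal
        -- at `z` and `a`.
        below : ∀ j → lookup (gateValues gs z) j Bool.≤ lookup (gateValues gs a) j
        equal : ∀ j → Known st j → lookup (gateValues gs z) j ≡ lookup (gateValues gs a) j

    open Agree

    node-≤ : ∀ {s} {gs : Gates n s} {st} → Agree gs st → ∀ p → at-z gs p Bool.≤ at-a gs p
    node-≤ agree (inj₁ i) = z≤a i
    node-≤ agree (inj₂ j) = below agree j

    node-≡ : ∀ {s} {gs : Gates n s} {st p} → Agree gs st → Settled st p → at-z gs p ≡ at-a gs p
    node-≡ agree (input eq)       = eq
    node-≡ agree (gate {j} known) = equal agree j known

    -- A gate known to be 0 at a is also 0 at z because z ≤ a on all nodes.
    extend : ∀ {s} {gs : Gates n s} {st st′} g m →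
      Consistent (m ∷ st) (gateValues (gs ▷ g) a) → st ⊑ st′ → Agree gs st′ →
      gateValue z (gateValues gs z) g Bool.≤ gateValue a (gateValues gs a) g →
      (m ≡ just true → gateValue z (gateValues gs z) g ≡ true) →
      Agree (gs ▷ g) (m ∷ st)
    extend {gs = gs} g m cons sub agree g≤ g-true = mkAgree
      (λ { zero → g≤ ; (suc j) → below agree j })
      (λ { zero → last m refl ; (suc j) → equal agree j ∘ preserve sub j })
      where
      last : ∀ m′ → m′ ≡ m → T (is-just m′) →
             gateValue z (gateValues gs z) g ≡ gateValue a (gateValues gs a) g
      last (just true)  refl _ = trans (g-true refl) (sym (correct cons zero refl))
      last (just false) refl _ = Bool.≤-antisym g≤
        (subst (Bool._≤ gateValue z (gateValues gs z) g) (sym (correct cons zero refl)) (Bool.≤-minimum _))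

    -- The three summands pay, in order, for AND and OR gates firing at `a`, for NOT gates firing at
    -- `𝟎`, and for unknown inputs of NOT gates that fire at `𝟎`.
    budget : ∀ {s} → Gates n s → State s → ℕ
    budget gs st = (firing (gateValues gs a) + firing (gateValues gs 𝟎)) + pending st (gateValues gs 𝟎)

    budget-anti : ∀ {s} (gs : Gates n s) {st st′} → st ⊑ st′ → budget gs st′ ≤ budget gs st
    budget-anti gs sub = +-monoʳ-≤ (firing (gateValues gs a) + _) (pending-anti sub (gateValues gs 𝟎))

    module _ {s} (gs : Gates n s) (g : Gate n s) (m : Maybe Bool) (st : State s) where

      private
        F₁ F₀ : ℕ
        F₁ = firing (gateValues gs a)
        F₀ = firing (gateValues gs 𝟎)

        F₁≤ : F₁ ≤ firing (gateValues (gs ▷ g) a)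
        F₁≤ = firing-∷ (gateValue a (gateValues gs a) g) (gateValues gs a)

        F₀≤ : F₀ ≤ firing (gateValues (gs ▷ g) 𝟎)
        F₀≤ = firing-∷ (gateValue 𝟎 (gateValues gs 𝟎) g) (gateValues gs 𝟎)

        pending≤ : pending st (gateValues gs 𝟎) ≤ pending (m ∷ st) (gateValues (gs ▷ g) 𝟎)
        pending≤ = pending-∷ m (gateValue 𝟎 (gateValues gs 𝟎) g) st (gateValues gs 𝟎)

        fires : ∀ {b} (v : Vec Bool s) → b ≡ true → suc (firing v) ≤ firing (b ∷ v)
        fires v refl = ≤-refl

      budget-▷ : budget gs st ≤ budget (gs ▷ g) (m ∷ st)
      budget-▷ = +-mono-≤ (+-mono-≤ F₁≤ F₀≤) pending≤

      budget-fires-at-a : gateValue a (gateValues gs a) g ≡ true →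
                          budget gs st < budget (gs ▷ g) (m ∷ st)
      budget-fires-at-a eq = +-mono-≤ (+-mono-≤ (fires (gateValues gs a) eq) F₀≤) pending≤

      budget-fires-at-𝟎 : gateValue 𝟎 (gateValues gs 𝟎) g ≡ true →
                          budget gs st < budget (gs ▷ g) (m ∷ st)
      budget-fires-at-𝟎 eq = +-mono-≤
        (≤-trans (≤-reflexive (sym (+-suc F₁ F₀))) (+-mono-≤ F₁≤ (fires (gateValues gs 𝟎) eq)))
        pending≤

    -- B is independent of st′ because the states reached after Alice's two
    -- possible answers must share one bound on the steps.
    budget-neg : ∀ {s} (gs : Gates n s) p m {st} → known? st p ≡ false →
      ∃ λ B → B < budget (gs ▷ neg p) (m ∷ st) ×
              (∀ {st′} → st ⊑ st′ → Settled st′ p → budget gs st′ ≤ B)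
    budget-neg gs p m {st} unknown = by-value-at-𝟎 p (at-𝟎 gs p) refl unknown
      where
      by-value-at-𝟎 : ∀ p b → at-𝟎 gs p ≡ b → known? st p ≡ false →
        ∃ λ B → B < budget (gs ▷ neg p) (m ∷ st) ×
                (∀ {st′} → st ⊑ st′ → Settled st′ p → budget gs st′ ≤ B)
      -- If `p` is 0 at `𝟎`, the NOT gate fires there; otherwise `p` fires there and, not being a
      -- variable, is a gate.
      by-value-at-𝟎 p false p₀ _ =
        budget gs st , budget-fires-at-𝟎 gs (neg p) m st (cong not p₀) , λ sub _ → budget-anti gs sub
      by-value-at-𝟎 (inj₁ i) true p₀ _ with () ← trans (sym p₀) (lookup-replicate i false)
      by-value-at-𝟎 (inj₂ j) true p₀ unknown =
        -- As `pending` sees only which gates are known, this state bounds the budget after either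
        -- answer, even if `p` is 0 at `a`.
        budget gs st₁ ,
        ≤-trans
          (≤-trans (≤-reflexive (sym (+-suc (firing (gateValues gs a) + firing (gateValues gs 𝟎)) _)))
                   (+-monoʳ-≤ (firing (gateValues gs a) + firing (gateValues gs 𝟎))
                              (pending-strict (⊑-update st j true) (gateValues gs 𝟎) j unknown
                                              (known-update st j true) p₀)))
          (budget-▷ gs (neg (inj₂ j)) m st) ,
        λ { sub (gate known) → budget-anti gs (update-least j sub known) }
        where st₁ = st [ j ]≔ just true

    -- A unit of budget buys two bits: two checks by Bob at an AND gate, or a bit from Alice and a
    -- check at an OR or NOT gate.
    2+2*m≤2*k : ∀ {m k} → m < k → suc (suc (2 * m)) ≤ 2 * k
    2+2*m≤2*k {m} m<k = ≤-trans (≤-reflexive (sym (*-suc 2 m))) (*-monoʳ-≤ 2 m<k)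

    -- Induction along the circuit

    skip : ∀ {s} {gs : Gates n s} {st π} g m →
      Consistent (m ∷ st) (gateValues (gs ▷ g) a) → m ≢ just true →
      (Agree gs st → gateValue z (gateValues gs z) g Bool.≤ gateValue a (gateValues gs a) g) →
      Play (Agree gs st) (2 * budget gs st) π →
      Play (Agree (gs ▷ g) (m ∷ st)) (2 * budget (gs ▷ g) (m ∷ st)) π
    skip {gs = gs} {st} g m cons m≢true g≤ =
      weaken (*-monoʳ-≤ 2 (budget-▷ gs g m st))
             (λ agree → extend g m cons ⊑-refl agree (g≤ agree) (⊥-elim ∘ m≢true))

    and-≤ : ∀ {s} {gs : Gates n s} {st} p q → Agree gs st →
            at-z gs p ∧ at-z gs q Bool.≤ at-a gs p ∧ at-a gs q
    and-≤ p q agree = ∧-mono-≤ (node-≤ agree p) (node-≤ agree q)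

    or-≤ : ∀ {s} {gs : Gates n s} {st} p q → Agree gs st →
           at-z gs p ∨ at-z gs q Bool.≤ at-a gs p ∨ at-a gs q
    or-≤ p q agree = ∨-mono-≤ (node-≤ agree p) (node-≤ agree q)

    -- NOT reverses the order, so `below` at `p` would point the wrong way; the equality at a
    -- settled `p` gives both parts of `Agree`.
    neg-extend : ∀ {s} {gs : Gates n s} {st st′} p m →
      Consistent (m ∷ st) (gateValues (gs ▷ neg p) a) → st ⊑ st′ → Settled st′ p →
      Agree gs st′ → Agree (gs ▷ neg p) (m ∷ st)
    neg-extend p m cons sub settled agree =
      extend (neg p) m cons sub agree (Bool.≤-reflexive same) (λ m≡true → trans same (correct cons zero m≡true))
      where same = cong not (node-≡ agree settled)

    -- Knowledge is passed from the root downwards through `st`, while `Agree` is built back upwards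
    -- from the result for the gates below.
    play : ∀ {s} (gs : Gates n s) st → Consistent st (gateValues gs a) →
           Play (Agree gs st) (2 * budget gs st) (protocol gs st)
    -- The answer here is `default`; it is not claimed to win, only that agreement holds, vacuously,
    -- on no gates.
    play ∅ [] cons = mkPlay z≤n (inj₂ (mkAgree (λ ()) (λ ())))
    play (gs ▷ and₂ p q) (just true ∷ st) cons =
      weaken (2+2*m≤2*k (budget-fires-at-a gs (and₂ p q) (just true) st both)) id
        (settle-play p true (∧-trueˡ both) (consistent-tail cons) λ st₁ cons₁ sub₁ settled₁ →
         settle-play q true (∧-trueʳ {at-a gs p} both) cons₁ λ st₂ cons₂ sub₂ settled₂ →
         weaken (*-monoʳ-≤ 2 (budget-anti gs (⊑-trans sub₁ sub₂)))
           (λ agree → extend (and₂ p q) (just true) cons (⊑-trans sub₁ sub₂) agree (and-≤ p q agree)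
             -- `p` was settled before `q`, so its status is carried over to the later state `st₂`.
             (λ _ → trans (cong₂ _∧_ (node-≡ agree (settled-⊑ sub₂ settled₁)) (node-≡ agree settled₂)) both))
           (play gs st₂ cons₂))
      where
      both : at-a gs p ∧ at-a gs q ≡ true
      both = correct cons zero refl
    play (gs ▷ or₂ p q) (just true ∷ st) cons =
      weaken (2+2*m≤2*k (budget-fires-at-a gs (or₂ p q) (just true) st either)) id
        (alice-play (reveal gs p)
          (λ p-true → settle-play p true p-true (consistent-tail cons) λ st′ cons′ sub settled →
            weaken (*-monoʳ-≤ 2 (budget-anti gs sub))
              (λ agree → extend (or₂ p q) (just true) cons sub agree (or-≤ p q agree)
                (λ _ → cong (_∨ at-z gs q) (trans (node-≡ agree settled) p-true)))
              (play gs st′ cons′))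
          (λ p-false → let q-true = trans (sym (cong (_∨ at-a gs q) p-false)) either in
            settle-play q true q-true (consistent-tail cons) λ st′ cons′ sub settled →
            weaken (*-monoʳ-≤ 2 (budget-anti gs sub))
              (λ agree → extend (or₂ p q) (just true) cons sub agree (or-≤ p q agree)
                (λ _ → trans (cong (at-z gs p ∨_) (trans (node-≡ agree settled) q-true)) (Bool.∨-zeroʳ (at-z gs p))))
              (play gs st′ cons′)))
      where
      either : at-a gs p ∨ at-a gs q ≡ true
      either = correct cons zero refl
    play (gs ▷ neg p) (m ∷ st) cons with known? st p in known
    ... | true  = weaken (*-monoʳ-≤ 2 (budget-▷ gs (neg p) m st))
                         (neg-extend p m cons ⊑-refl (known⇒settled p known))
                         (play gs st (consistent-tail cons))
    ... | false with B , B< , ≤B ← budget-neg gs p m {st} known =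
      weaken (2+2*m≤2*k B<) id (alice-play (reveal gs p) (ask true) (ask false))
      where
      ask : ∀ b → at-a gs p ≡ b →
            Play (Agree (gs ▷ neg p) (m ∷ st)) (suc (2 * B)) (settle p b st (protocol gs))
      ask b eq = settle-play p b eq (consistent-tail cons) λ st′ cons′ sub settled →
        weaken (*-monoʳ-≤ 2 (≤B sub settled)) (neg-extend p m cons sub settled) (play gs st′ cons′)
    play (gs ▷ and₂ p q) (nothing ∷ st) cons =
      skip (and₂ p q) nothing cons (λ ()) (and-≤ p q) (play gs st (consistent-tail cons))
    play (gs ▷ and₂ p q) (just false ∷ st) cons =
      skip (and₂ p q) (just false) cons (λ ()) (and-≤ p q) (play gs st (consistent-tail cons))
    play (gs ▷ or₂ p q) (nothing ∷ st) cons =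
      skip (or₂ p q) nothing cons (λ ()) (or-≤ p q) (play gs st (consistent-tail cons))
    play (gs ▷ or₂ p q) (just false ∷ st) cons =
      skip (or₂ p q) (just false) cons (λ ()) (or-≤ p q) (play gs st (consistent-tail cons))

  -- From a circuit to a bound on the game

  initial : ∀ {s} → State (suc s)
  initial = just true ∷ replicate _ nothing

  module _ (C : Circuit n) (computes : Computes C f) (monotone : Monotone f) where

    open Circuit C

    protocol-wins : ∀ x y →
      steps (protocol gates initial) x y ≤ 6 * energy C ×
      Run.Wins x y (run (protocol gates initial) x y)
    protocol-wins x y = ≤-trans (Play.short played) bound , wins (Play.outcome played)
      where
      open Run x y

      -- Alice's input satisfies `f a ≡ true`, so the root is known to be 1 before any bit is sent.
      root : ∀ {s} (gs : Gates n (suc s)) → Vec.head (gateValues gs a) ≡ true →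
             Consistent initial (gateValues gs a)
      root gs eq with gateValues gs a
      ... | b ∷ v = mkConsistent λ
        { zero    refl → eq
        ; (suc j) h    → ⊥-elim (nothing≢just (trans (sym (lookup-replicate j nothing)) h)) }
        where
        nothing≢just : ∀ {c : Bool} → nothing ≢ just c
        nothing≢just ()

      played = play gates initial (root gates (trans (computes a) (proj₂ x)))

      head≡lookup : ∀ {s} (v : Vec Bool (suc s)) → Vec.head v ≡ lookup v zero
      head≡lookup (_ ∷ _) = refl

      fz≡true : Agree gates initial → f z ≡ true
      fz≡true agree = begin
        f z                               ≡⟨ computes z ⟨
        eval C z                          ≡⟨ head≡lookup (gateValues gates z) ⟩
        lookup (gateValues gates z) zero  ≡⟨ Agree.equal agree zero tt ⟩
        lookup (gateValues gates a) zero  ≡⟨ head≡lookup (gateValues gates a) ⟨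
        eval C a                          ≡⟨ computes a ⟩
        f a                               ≡⟨ proj₂ x ⟩
        true                              ∎
        where open ≡-Reasoning

      wins : ∀ {i} → Wins i ⊎ Agree gates initial → Wins i
      wins (inj₁ won)   = won
      wins (inj₂ agree)
        with () ← subst₂ Bool._≤_ (fz≡true agree) (proj₂ y) (monotone z (proj₁ y) z≤y)

      -- Each of the three summands of the budget is at most the energy, and a unit pays for two
      -- bits.
      bound : 2 * budget gates initial ≤ 6 * energy C
      bound = begin
        2 * budget gates initial                  ≤⟨ *-monoʳ-≤ 2 (+-mono-≤ (+-mono-≤ (at a) (at 𝟎))
                                                       (≤-trans (pending≤firing initial (gateValues gates 𝟎)) (at 𝟎))) ⟩
        2 * ((energy C + energy C) + energy C)    ≡⟨ regroup (energy C) ⟩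
        6 * energy C                              ∎
        where
        open ≤-Reasoning
        at : ∀ b → energyAt C b ≤ energy C
        at = ≤-maxCube (energyAt C)
        open +-*-Solver
        regroup : ∀ e → 2 * ((e + e) + e) ≡ 6 * e
        regroup = solve 1 (λ e → con 2 :* ((e :+ e) :+ e) := con 6 :* e) refl

    KW⁺≤6*energy : ∃ λ π → SolvesKW⁺ f π × cost π ≤ 6 * energy C
    KW⁺≤6*energy = π , solves , cost-truncate default (6 * energy C) (protocol gates initial)
      where
      π = truncate default (6 * energy C) (protocol gates initial)
      solves : SolvesKW⁺ f π
      solves x y with short , won ← protocol-wins x y =
        subst (Run.Wins x y) (sym (run-truncate default (6 * energy C) (protocol gates initial) short)) won

theorem1p3 : ∃ λ (c : ℚ) → (c > 0ℚ) ×
    (∀ (n : ℕ) → n ≥ 1 → (f : BoolFun n) → Monotone f →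
    ∀ (e k : ℕ) → IsEC f e → IsKW⁺ f k →
    fromℕ e ≥ℚ (c *ℚ fromℕ k))
theorem1p3 = ℤ.+ 1 / 6 , ℚ.positive⁻¹ (ℤ.+ 1 / 6) , bound
  where
  bound : ∀ n → n ≥ 1 → (f : BoolFun n) → Monotone f → ∀ e k → IsEC f e → IsKW⁺ f k →
          fromℕ e ≥ℚ ((ℤ.+ 1 / 6) *ℚ fromℕ k)
  -- From `n ≥ 1` comes the variable `zero` used as `default`; `refl` makes `e` the energy of an
  -- optimal circuit `C`.
  bound (suc n) _ f monotone _ k ((C , computes , refl) , _) (_ , k-least)
    with π , solves , cost≤ ← Game.KW⁺≤6*energy f zero C computes monotone =
    1/6*m≤n k (energy C) (≤-trans (k-least (cost π) (π , solves , refl)) cost≤)
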